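{- For every integer $k\ge1$ and every $s=0,\dots,k$ the identity $$\sum_{m=1}^{s}\sum_{m,s}C_{\alpha_1,\dots,\alpha_s}^{s,m,k}=(-1)^{s}S(k,k-s)$$ holds.
   Context: $S(k,s)$ are the (signed) Stirling numbers of the first kind: $x(x-1)\cdots(x-k+1)=\sum_{s=0}^{k}S(k,s)x^{s}$. For integers $k\ge1$, $1\le s\le k-1$, $1\le m\le s$ and nonnegative integers $\alpha_1,\dots,\alpha_s$ with $\sum_{i=1}^s\alpha_i=m$, $\sum_{i=1}^s i\alpha_i=s$, the numbers $C_{\alpha_1,\dots,\alpha_s}^{s,m,k}$ are the uniquely determined universal numbers (not depending on $u$) such that for every entire or meromorphic function $u$ on $\mathbb{C}$ the operator $A=u(z)\frac{d}{dz}$ satisfies $$A^{k}=u^k\Big(\frac{d}{dz}\Big)^k+\sum_{s=1}^{k-1}\Big(\sum_{m=1}^{s}u^{k-m}\sum_{m,s}C_{\alpha_1,\dots,\alpha_s}^{s,m,k}\Big(\frac{du}{dz}\Big)^{\alpha_1}\cdots\Big(\frac{d^su}{dz^s}\Big)^{\alpha_s}\Big)\Big(\frac{d}{dz}\Big)^{k-s},$$ where $\sum_{m,s}$ is over all nonnegative integers $\alpha_1,\dots,\alpha_s$ with $\sum_{i=1}^s\alpha_i=m$ and $\sum_{i=1}^s i\alpha_i=s$. Conventions: for $s=0$ the double sum $\sum_{m=1}^{s}\sum_{m,s}$ is understood to equal $1$ (coefficient of $u^k(d/dz)^k$), and $C_{\alpha_1,\dots,\alpha_k}^{k,m,k}=0$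 (the coefficient of $(d/dz)^0$ in $A^k$ is $0$). -}

module Defs where

open import Level using (Level; _⊔_) renaming (suc to lsuc)
open import Algebra.Apartness.Bundles using (HeytingField; HeytingCommutativeRing)
open import Algebra.Bundles using (CommutativeRing)
open import Algebra.Morphism.Structures using (module RingMorphisms)
import Algebra.Properties.Semiring.Exp as SemiringExp
import Algebra.Properties.Semiring.Mult as SemiringMult
open import Data.Fin.Base using (toℕ)
open import Data.Integer.Base as ℤ using (ℤ; +_; -[1+_]; 0ℤ; 1ℤ; -1ℤ)
open import Data.List.Base as List using (List; []; _∷_)
open import Data.List.Membership.Propositional using (_∈_)
open import Data.List.Membership.Propositional.Properties
  using (∈-filter⁺; ∈-filter⁻; ∈-cartesianProductWith⁺; ∈-upTo⁺)
open import Data.List.Relation.Unary.Any using (here)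
open import Data.List.Relation.Unary.Unique.Propositional using (Unique; []; _∷_)
import Data.List.Relation.Unary.Unique.Propositional.Properties as Unique
open import Data.List.Relation.Unary.All using ([])
open import Data.Nat.Base as ℕ using (ℕ; zero; suc; _∸_; _≤_; s≤s)
open import Data.Nat.GeneralisedArithmetic using (fold)
import Data.Nat.Properties as ℕ
open import Data.Product.Base using (_×_; _,_; proj₂)
open import Data.Vec.Base as Vec using (Vec; []; _∷_)
open import Data.Vec.Properties using (∷-injective)
open import Data.Vec.Relation.Unary.All as All using (All; []; _∷_)
open import Function.Bundles using (_⇔_; mk⇔)
open import Relation.Binary.PropositionalEquality using (_≡_; refl; subst)
open import Relation.Nullary.Decidable using (Dec; _×-dec_)

private
  variable
    c ℓ₁ ℓ₂ a ℓ : Level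

------------------------------------------------------------------------
-- Signed Stirling numbers of the first kind

-- Integer polynomials as coefficient lists, constant term first.
Poly : Set
Poly = List ℤ

_+ₚ_ : Poly → Poly → Poly
[]      +ₚ q       = q
(x ∷ p) +ₚ []      = x ∷ p
(x ∷ p) +ₚ (y ∷ q) = (x ℤ.+ y) ∷ (p +ₚ q)

_*ₚ_ : Poly → Poly → Poly
[]      *ₚ q = []
(x ∷ p) *ₚ q = List.map (x ℤ.*_) q +ₚ (0ℤ ∷ (p *ₚ q))

coeff : Poly → ℕ → ℤ
coeff []      _       = 0ℤ
coeff (x ∷ p) zero    = x
coeff (x ∷ p) (suc n) = coeff p n

-- x (x - 1) ⋯ (x - k + 1)
fallingFactorial : ℕ → Poly
fallingFactorial zero    = 1ℤ ∷ []
fallingFactorial (suc k) = (ℤ.- (+ k) ∷ 1ℤ ∷ []) *ₚ fallingFactorial k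

S : ℕ → ℕ → ℤ
S k s = coeff (fallingFactorial k) s

------------------------------------------------------------------------
-- The index set of the sum Σ_{m,s}

-- α₁ + 2 α₂ + ⋯ + s αₛ
weight : ∀ {s} → Vec ℕ s → ℕ
weight α = Vec.sum (Vec.zipWith ℕ._*_ (Vec.tabulate (λ i → suc (toℕ i))) α)

Admissible : ∀ (m s : ℕ) → Vec ℕ s → Set
Admissible m s α = Vec.sum α ≡ m × weight α ≡ s

admissible? : ∀ m s (α : Vec ℕ s) → Dec (Admissible m s α)
admissible? m s α = (Vec.sum α ℕ.≟ m) ×-dec (weight α ℕ.≟ s)

-- All s-tuples with entries in {0,…,b}.
boundedTuples : ℕ → (s : ℕ) → List (Vec ℕ s)
boundedTuples b zero    = [] ∷ []
boundedTuples b (suc s) =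
  List.cartesianProductWith _∷_ (List.upTo (suc b)) (boundedTuples b s)

-- Bounding the entries by m loses nothing, since Σ αᵢ = m; see
-- ∈-admissibleTuples and admissibleTuples-unique below.
admissibleTuples : (m s : ℕ) → List (Vec ℕ s)
admissibleTuples m s = List.filter (admissible? m s) (boundedTuples m s)

private
  ∈-boundedTuples : ∀ {b s} {α : Vec ℕ s} → All (_≤ b) α → α ∈ boundedTuples b s
  ∈-boundedTuples []       = here refl
  ∈-boundedTuples (p ∷ ps) =
    ∈-cartesianProductWith⁺ _∷_ (∈-upTo⁺ (s≤s p)) (∈-boundedTuples ps)

  entries≤sum : ∀ {s} (α : Vec ℕ s) → All (_≤ Vec.sum α) α
  entries≤sum []      = []
  entries≤sum (x ∷ α) = ℕ.m≤m+n x (Vec.sum α)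
    ∷ All.map (λ p → ℕ.≤-trans p (ℕ.m≤n+m (Vec.sum α) x)) (entries≤sum α)

  boundedTuples-unique : ∀ b s → Unique (boundedTuples b s)
  boundedTuples-unique b zero    = [] ∷ []
  boundedTuples-unique b (suc s) =
    Unique.cartesianProductWith⁺ _∷_ ∷-injective
      (Unique.upTo⁺ (suc b)) (boundedTuples-unique b s)

∈-admissibleTuples : ∀ m s (α : Vec ℕ s) → α ∈ admissibleTuples m s ⇔ Admissible m s α
∈-admissibleTuples m s α = mk⇔
  (λ α∈ → proj₂ (∈-filter⁻ (admissible? m s) {xs = boundedTuples m s} α∈))
  (λ { ad@(refl , _) → ∈-filter⁺ (admissible? m s) (∈-boundedTuples (entries≤sum α)) ad })

admissibleTuples-unique : ∀ m s → Unique (admissibleTuples m s)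
admissibleTuples-unique m s = Unique.filter⁺ (admissible? m s) (boundedTuples-unique m s)

------------------------------------------------------------------------
-- Rings

-- [1⋯ n ] = 1, 2, …, n; empty for n = 0.
[1⋯_] : ℕ → List ℕ
[1⋯ n ] = List.applyUpTo suc n

module RingNotation (R : CommutativeRing c ℓ) where
  open CommutativeRing R public
  open SemiringMult semiring public using () renaming (_×_ to _·_)
  open SemiringExp semiring public using (_^_)

  ∑ : {X : Set a} → List X → (X → Carrier) → Carrier
  ∑ xs f = List.foldr _+_ 0# (List.map f xs)

  infix 5 ∑
  syntax ∑ xs (λ x → e) = ∑[ x ∈ xs ] e

  fromℤ : ℤ → Carrier
  fromℤ (+ n)    = n · 1#
  fromℤ -[1+ n ] = - (suc n · 1#)

scalars : HeytingField c ℓ₁ ℓ₂ → CommutativeRing c ℓ₁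
scalars K = HeytingCommutativeRing.commutativeRing (HeytingField.heytingCommutativeRing K)

CharZero : HeytingField c ℓ₁ ℓ₂ → Set ℓ₂
CharZero K = ∀ n → (suc n · 1#) # 0#
  where
  open HeytingField K using (_#_)
  open RingNotation (scalars K) using (_·_; 1#; 0#)

-- A commutative ring of functions of one variable z, with its derivation
-- ∂ = d/dz and with the numbers of K as the constant functions.  The
-- meromorphic functions on ℂ, and the entire functions on ℂ, are instances
-- with K = ℂ.
record FunctionRing (K : HeytingField c ℓ₁ ℓ₂) a ℓ : Set (c ⊔ ℓ₁ ⊔ lsuc (a ⊔ ℓ)) where
  field
    functions : CommutativeRing a ℓ
  open CommutativeRing functions
  field
    const      : HeytingField.Carrier K → Carrier
    const-mono : RingMorphisms.IsRingMonomorphism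
                   (CommutativeRing.rawRing (scalars K)) rawRing const
    ∂          : Carrier → Carrier
    ∂-cong     : ∀ {f g} → f ≈ g → ∂ f ≈ ∂ g
    ∂-+        : ∀ f g → ∂ (f + g) ≈ ∂ f + ∂ g
    ∂-*        : ∀ f g → ∂ (f * g) ≈ ∂ f * g + f * ∂ g
    ∂-const    : ∀ x → ∂ (const x) ≈ 0#
    z          : Carrier
    ∂-z        : ∂ z ≈ 1#

------------------------------------------------------------------------
-- The numbers C^{s,m,k}_{α₁,…,αₛ}

-- C s m k α; only values at admissible α with 1 ≤ m ≤ s ≤ k and k ≥ 1 matter.
Coefficients : HeytingField c ℓ₁ ℓ₂ → Set c
Coefficients K = (s m k : ℕ) → Vec ℕ s → HeytingField.Carrier K

module _ {K : HeytingField c ℓ₁ ℓ₂} (𝓜 : FunctionRing K a ℓ) where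
  open FunctionRing 𝓜
  open RingNotation functions

  -- The operator u d/dz.
  A : Carrier → Carrier → Carrier
  A u f = u * ∂ f

  -- f ↦ Tᵏ f
  power : (Carrier → Carrier) → ℕ → Carrier → Carrier
  power T k f = fold f T k

  -- (∂ u)^α₁ (∂² u)^α₂ ⋯ (∂ˢ u)^αₛ
  jetMonomial : ∀ {s} → Carrier → Vec ℕ s → Carrier
  jetMonomial u []      = 1#
  jetMonomial u (i ∷ α) = (∂ u ^ i) * jetMonomial (∂ u) α

  expansion : Coefficients K → (k : ℕ) (u f : Carrier) → Carrier
  expansion C k u f =
    (u ^ k) * power ∂ k f
    + (∑[ s ∈ [1⋯ k ∸ 1 ] ]
        (∑[ m ∈ [1⋯ s ] ]
          (u ^ (k ∸ m)) *
          (∑[ α ∈ admissibleTuples m s ] (const (C s m k α) * jetMonomial u α)))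
        * power ∂ (k ∸ s) f)

  -- The operator identity defines C s m k for s < k; `boundary` is the
  -- convention for s = k, which records that Aᵏ has no term of order 0.
  record IsUniversal (C : Coefficients K) : Set (c ⊔ ℓ₁ ⊔ a ⊔ ℓ) where
    field
      operator-identity : ∀ k → 1 ≤ k → ∀ u f → power (A u) k f ≈ expansion C k u f
      boundary : ∀ k m → 1 ≤ m → m ≤ k → ∀ α → Admissible m k α →
                 HeytingField._≈_ K (C k m k α) (HeytingField.0# K)

-- Σ_{m=1}^{s} Σ_{m,s} C s m k α, read as 1 when s = 0.
coefficientSum : (K : HeytingField c ℓ₁ ℓ₂) → Coefficients K →
                 (k s : ℕ) → HeytingField.Carrier K
coefficientSum K C k zero      = HeytingField.1# K
coefficientSum K C k s@(suc _) =
  ∑[ m ∈ [1⋯ s ] ] (∑[ α ∈ admissibleTuples m s ] C s m k α)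
  where open RingNotation (scalars K)

-- (-1)ˢ S(k, k - s) as an element of K.
signedStirling : (K : HeytingField c ℓ₁ ℓ₂) → (k s : ℕ) → HeytingField.Carrier K
signedStirling K k s = RingNotation.fromℤ (scalars K) ((-1ℤ ℤ.^ s) ℤ.* S k (k ∸ s))

{-# OPTIONS --safe #-}
module Submission where

-- Evaluate the operator identity at z = 0 for u = 1 + z + ⋯ + z^N / N! with N
-- large and f = zⁿ / n!, n = k - s.  Every jet monomial of u takes the value 1
-- at 0 and ∂ʲ f vanishes there unless j = n, so the expansion takes the value
-- Σ C.  On the other hand ∂ u = u up to order N, hence up to order N - k
-- (u ∂)ᵏ f = uᵏ (∂ + k - 1) ⋯ (∂ + 1) ∂ f, whose value at 0 is the unsigned
-- Stirling number c(k , n).  Only polynomials in z need to be evaluated at 0,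
-- and z is transcendental over the constants in characteristic zero.

open import Defs
open import Algebra.Apartness.Bundles using (HeytingField)
open import Data.Nat.Base as ℕ using (ℕ; zero; suc; _∸_; _≤_; _<_; z≤n; s≤s)
open import Level using (Level; _⊔_)
open import Algebra.Bundles using (CommutativeRing)
open import Algebra.Morphism.Structures using (module RingMorphisms)
import Algebra.Properties.Ring as RingProperties
import Algebra.Properties.Semiring.Mult as SemiringMult
import Algebra.Solver.Ring.NaturalCoefficients.Default as SemiringSolver
open import Data.Integer.Base as ℤ using (ℤ; +_; 0ℤ; 1ℤ; -1ℤ)
import Data.Integer.Properties as ℤ
open import Data.Integer.Solver using () renaming (module +-*-Solver to ℤ-Solver)
open import Data.List.Base as List using (List; []; _∷_; length)
open import Data.List.Membership.Propositional using (_∈_)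
open import Data.List.Membership.Propositional.Properties using (∈-applyUpTo⁻)
open import Data.List.Relation.Unary.All using (All; []; _∷_)
open import Data.List.Relation.Unary.Any using (here; there)
import Data.Nat.Properties as ℕ
open import Data.Product.Base using (∃-syntax; _×_; _,_; proj₁; proj₂)
open import Data.Sum.Base using (inj₁; inj₂)
open import Data.Vec.Base using (Vec; []; _∷_)
open import Function.Base using (_∘_; id)
open import Function.Bundles using (Equivalence)
open import Relation.Binary.PropositionalEquality as ≡ using (_≡_; _≢_)
import Relation.Binary.Reasoning.Setoid as SetoidReasoning
open import Relation.Nullary.Negation using (contradiction)

private
  variable
    c ℓ₁ ℓ₂ a ℓ : Level

-- Stirling numbers of the first kind

coeff-+ₚ : ∀ p q n → coeff (p +ₚ q) n ≡ coeff p n ℤ.+ coeff q n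
coeff-+ₚ []      q       n       = ≡.sym (ℤ.+-identityˡ _)
coeff-+ₚ (x ∷ p) []      n       = ≡.sym (ℤ.+-identityʳ _)
coeff-+ₚ (x ∷ p) (y ∷ q) zero    = ≡.refl
coeff-+ₚ (x ∷ p) (y ∷ q) (suc n) = coeff-+ₚ p q n

coeff-map-* : ∀ x p n → coeff (List.map (x ℤ.*_) p) n ≡ x ℤ.* coeff p n
coeff-map-* x []      n       = ≡.sym (ℤ.*-zeroʳ x)
coeff-map-* x (y ∷ p) zero    = ≡.refl
coeff-map-* x (y ∷ p) (suc n) = coeff-map-* x p n

S-suc-zero : ∀ k → S (suc k) 0 ≡ ℤ.- (+ k) ℤ.* S k 0
S-suc-zero k = begin
  S (suc k) 0
    ≡⟨ coeff-+ₚ (List.map (ℤ.- (+ k) ℤ.*_) p) _ 0 ⟩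
  coeff (List.map (ℤ.- (+ k) ℤ.*_) p) 0 ℤ.+ 0ℤ         ≡⟨ ℤ.+-identityʳ _ ⟩
  coeff (List.map (ℤ.- (+ k) ℤ.*_) p) 0                ≡⟨ coeff-map-* (ℤ.- (+ k)) p 0 ⟩
  ℤ.- (+ k) ℤ.* S k 0                                  ∎
  where
  open ≡.≡-Reasoning
  p = fallingFactorial k

S-suc-suc : ∀ k n → S (suc k) (suc n) ≡ ℤ.- (+ k) ℤ.* S k (suc n) ℤ.+ S k n
S-suc-suc k n = begin
  S (suc k) (suc n)
    ≡⟨ coeff-+ₚ (List.map (ℤ.- (+ k) ℤ.*_) p) _ (suc n) ⟩
  coeff (List.map (ℤ.- (+ k) ℤ.*_) p) (suc n) ℤ.+ coeff (List.map (1ℤ ℤ.*_) p +ₚ (0ℤ ∷ [])) n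
    ≡⟨ ≡.cong₂ ℤ._+_ (coeff-map-* (ℤ.- (+ k)) p (suc n)) (coeff-+ₚ (List.map (1ℤ ℤ.*_) p) _ n) ⟩
  ℤ.- (+ k) ℤ.* S k (suc n) ℤ.+ (coeff (List.map (1ℤ ℤ.*_) p) n ℤ.+ coeff (0ℤ ∷ []) n)
    ≡⟨ ≡.cong (λ x → ℤ.- (+ k) ℤ.* S k (suc n) ℤ.+ x)
         (≡.cong₂ ℤ._+_ (≡.trans (coeff-map-* 1ℤ p n) (ℤ.*-identityˡ _)) (coeff-0 n)) ⟩
  ℤ.- (+ k) ℤ.* S k (suc n) ℤ.+ (S k n ℤ.+ 0ℤ)
    ≡⟨ ≡.cong (λ x → ℤ.- (+ k) ℤ.* S k (suc n) ℤ.+ x) (ℤ.+-identityʳ _) ⟩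
  ℤ.- (+ k) ℤ.* S k (suc n) ℤ.+ S k n ∎
  where
  open ≡.≡-Reasoning
  p = fallingFactorial k
  coeff-0 : ∀ n → coeff (0ℤ ∷ []) n ≡ 0ℤ
  coeff-0 zero    = ≡.refl
  coeff-0 (suc n) = ≡.refl

-- The number c(k , n) of permutations of k letters with n cycles, that is, the coefficient of xⁿ in
-- x (x + 1) ⋯ (x + k - 1).
unsignedStirling : ℕ → ℕ → ℕ
unsignedStirling zero    zero    = 1
unsignedStirling zero    (suc n) = 0
unsignedStirling (suc k) zero    = k ℕ.* unsignedStirling k zero
unsignedStirling (suc k) (suc n) = unsignedStirling k n ℕ.+ k ℕ.* unsignedStirling k (suc n)

unsignedStirling-zero : ∀ k → unsignedStirling (suc k) 0 ≡ 0
unsignedStirling-zero zero    = ≡.refl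
unsignedStirling-zero (suc k) =
  ≡.trans (≡.cong (suc k ℕ.*_) (unsignedStirling-zero k)) (ℕ.*-zeroʳ (suc k))

-- Replacing x by -x turns the falling factorial into (-1)ᵏ times the rising one. A sign on either
-- side avoids a case distinction on the parity of k - n; the induction compares the two
-- recurrences.
S-sign : ∀ k n → (-1ℤ ℤ.^ k) ℤ.* S k n ≡ (-1ℤ ℤ.^ n) ℤ.* (+ unsignedStirling k n)
S-sign zero    zero    = ≡.refl
S-sign zero    (suc n) = ≡.sym (ℤ.*-zeroʳ (-1ℤ ℤ.^ suc n))
S-sign (suc k) zero    = begin
  (-1ℤ ℤ.* x) ℤ.* S (suc k) 0                ≡⟨ ≡.cong ((-1ℤ ℤ.* x) ℤ.*_) (S-suc-zero k) ⟩
  (-1ℤ ℤ.* x) ℤ.* (ℤ.- (+ k) ℤ.* S k 0)      ≡⟨ solve 3 (λ x k s →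
    (con -1ℤ :* x) :* (:- k :* s) := k :* (x :* s)) ≡.refl x (+ k) (S k 0) ⟩
  (+ k) ℤ.* (x ℤ.* S k 0)                    ≡⟨ ≡.cong ((+ k) ℤ.*_) (S-sign k 0) ⟩
  (+ k) ℤ.* (1ℤ ℤ.* t)                       ≡⟨ ≡.cong ((+ k) ℤ.*_) (ℤ.*-identityˡ t) ⟩
  (+ k) ℤ.* t                                ≡⟨ ℤ.pos-* k (unsignedStirling k 0) ⟨
  + (k ℕ.* unsignedStirling k 0)             ≡⟨ ℤ.*-identityˡ _ ⟨
  1ℤ ℤ.* (+ (k ℕ.* unsignedStirling k 0))    ∎
  where
  open ≡.≡-Reasoning
  open ℤ-Solver
  x = -1ℤ ℤ.^ k
  t = + unsignedStirling k 0
S-sign (suc k) (suc n) = begin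
  (-1ℤ ℤ.* x) ℤ.* S (suc k) (suc n)
    ≡⟨ ≡.cong ((-1ℤ ℤ.* x) ℤ.*_) (S-suc-suc k n) ⟩
  (-1ℤ ℤ.* x) ℤ.* (ℤ.- (+ k) ℤ.* S k (suc n) ℤ.+ S k n)
    ≡⟨ solve 4 (λ x k s s′ → (con -1ℤ :* x) :* (:- k :* s′ :+ s) := k :* (x :* s′) :- x :* s)
         ≡.refl x (+ k) (S k n) (S k (suc n)) ⟩
  (+ k) ℤ.* (x ℤ.* S k (suc n)) ℤ.- x ℤ.* S k n
    ≡⟨ ≡.cong₂ (λ p q → (+ k) ℤ.* p ℤ.- q) (S-sign k (suc n)) (S-sign k n) ⟩
  (+ k) ℤ.* ((-1ℤ ℤ.* y) ℤ.* t′) ℤ.- y ℤ.* t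
    ≡⟨ solve 4 (λ y k t t′ → k :* ((con -1ℤ :* y) :* t′) :- y :* t := (con -1ℤ :* y) :* (t :+ k :* t′))
         ≡.refl y (+ k) t t′ ⟩
  (-1ℤ ℤ.* y) ℤ.* (t ℤ.+ (+ k) ℤ.* t′)
    ≡⟨ ≡.cong (λ p → (-1ℤ ℤ.* y) ℤ.* (t ℤ.+ p)) (ℤ.pos-* k (unsignedStirling k (suc n))) ⟨
  (-1ℤ ℤ.* y) ℤ.* (+ unsignedStirling (suc k) (suc n)) ∎
  where
  open ≡.≡-Reasoning
  open ℤ-Solver
  x  = -1ℤ ℤ.^ k
  y  = -1ℤ ℤ.^ n
  t  = + unsignedStirling k n
  t′ = + unsignedStirling k (suc n)

sign-square : ∀ n → (-1ℤ ℤ.^ n) ℤ.* (-1ℤ ℤ.^ n) ≡ 1ℤ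
sign-square zero    = ≡.refl
sign-square (suc n) = ≡.trans
  (solve 1 (λ x → (con -1ℤ :* x) :* (con -1ℤ :* x) := x :* x) ≡.refl (-1ℤ ℤ.^ n))
  (sign-square n)
  where open ℤ-Solver

signed≡unsigned : ∀ k s → s ≤ k → (-1ℤ ℤ.^ s) ℤ.* S k (k ∸ s) ≡ + unsignedStirling k (k ∸ s)
signed≡unsigned k s s≤k = begin
  x ℤ.* S k n                  ≡⟨ ℤ.*-identityˡ _ ⟨
  -- The inserted square of (-1)ⁿ supplies the missing sign: one factor completes (-1)ˢ to (-1)ᵏ, so
  -- that `S-sign` applies, and the other cancels the (-1)ⁿ it produces.
  1ℤ ℤ.* (x ℤ.* S k n)         ≡⟨ ≡.cong (ℤ._* (x ℤ.* S k n)) (sign-square n) ⟨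
  (y ℤ.* y) ℤ.* (x ℤ.* S k n)
    ≡⟨ solve 3 (λ x y s → (y :* y) :* (x :* s) := y :* ((x :* y) :* s)) ≡.refl x y (S k n) ⟩
  y ℤ.* ((x ℤ.* y) ℤ.* S k n)  ≡⟨ ≡.cong (λ p → y ℤ.* (p ℤ.* S k n)) sign-k ⟨
  y ℤ.* ((-1ℤ ℤ.^ k) ℤ.* S k n) ≡⟨ ≡.cong (y ℤ.*_) (S-sign k n) ⟩
  y ℤ.* (y ℤ.* t)              ≡⟨ ℤ.*-assoc y y t ⟨
  (y ℤ.* y) ℤ.* t              ≡⟨ ≡.cong (ℤ._* t) (sign-square n) ⟩
  1ℤ ℤ.* t                     ≡⟨ ℤ.*-identityˡ t ⟩
  t                            ∎
  where
  open ≡.≡-Reasoning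
  open ℤ-Solver
  n = k ∸ s
  x = -1ℤ ℤ.^ s
  y = -1ℤ ℤ.^ n
  t = + unsignedStirling k n
  sign-k : -1ℤ ℤ.^ k ≡ x ℤ.* y
  sign-k = ≡.trans (≡.cong (-1ℤ ℤ.^_) (≡.sym (ℕ.m+[n∸m]≡n s≤k))) (ℤ.^-distribˡ-+-* -1ℤ s n)

-- Finite sums

module Sums (R : CommutativeRing c ℓ) where
  open RingNotation R

  -- The summand is controlled only on members of the list, which suits the boundary convention: it
  -- speaks of admissible tuples alone.
  ∑-zero : {X : Set a} (xs : List X) {f : X → Carrier} →
           (∀ {x} → x ∈ xs → f x ≈ 0#) → ∑ xs f ≈ 0#
  ∑-zero []       f≈0 = refl
  ∑-zero (x ∷ xs) f≈0 =
    trans (+-cong (f≈0 (here ≡.refl)) (∑-zero xs (f≈0 ∘ there))) (+-identityˡ 0#)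

  -- The enumeration g is kept general because the tail of the list is enumerated by `g ∘ suc`.
  ∑-single : ∀ (g : ℕ → ℕ) n {f : ℕ → Carrier} {j} → j < n →
             (∀ {i} → i < n → i ≢ j → f (g i) ≈ 0#) → ∑ (List.applyUpTo g n) f ≈ f (g j)
  ∑-single g (suc n) {f} {zero} j<n f≈0 = trans
    (+-congˡ (∑-zero (List.applyUpTo (g ∘ suc) n) tail≈0)) (+-identityʳ _)
    where
    tail≈0 : ∀ {x} → x ∈ List.applyUpTo (g ∘ suc) n → f x ≈ 0#
    tail≈0 x∈ with ∈-applyUpTo⁻ (g ∘ suc) x∈
    ... | i , i<n , ≡.refl = f≈0 (s≤s i<n) λ ()
  ∑-single g (suc n) {j = suc j} (s≤s j<n) f≈0 = trans
    (+-cong (f≈0 (s≤s z≤n) λ ())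
      (∑-single (g ∘ suc) n j<n λ i<n i≢j → f≈0 (s≤s i<n) (i≢j ∘ ℕ.suc-injective)))
    (+-identityˡ _)

module Evaluation {K : HeytingField c ℓ₁ ℓ₂} (char0 : CharZero K) (𝓜 : FunctionRing K a ℓ) where
  open FunctionRing 𝓜
  open RingNotation functions
  open SetoidReasoning setoid
  open SemiringSolver commutativeSemiring using (solve; _:+_; _:*_; _:=_; con)

  module K where
    open RingNotation (scalars K) public
    open SemiringMult (CommutativeRing.semiring (scalars K)) public using (×-homo-+; ×1-homo-*; ×-congˡ)
    open RingProperties (CommutativeRing.ring (scalars K)) public using (x∙y⁻¹≈ε⇒x≈y)

  module const where
    open RingMorphisms.IsRingMonomorphism const-mono public
      renaming (⟦⟧-cong to cong)

  -- Derivations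

  ∂-0 : ∂ 0# ≈ 0#
  ∂-0 = trans (∂-cong (sym const.0#-homo)) (∂-const K.0#)

  ∂-1 : ∂ 1# ≈ 0#
  ∂-1 = trans (∂-cong (sym const.1#-homo)) (∂-const K.1#)

  ∂-const-* : ∀ x f → ∂ (const x * f) ≈ const x * ∂ f
  ∂-const-* x f = begin
    ∂ (const x * f)                 ≈⟨ ∂-* (const x) f ⟩
    ∂ (const x) * f + const x * ∂ f ≈⟨ +-congʳ (trans (*-congʳ (∂-const x)) (zeroˡ f)) ⟩
    0# + const x * ∂ f              ≈⟨ +-identityˡ _ ⟩
    const x * ∂ f                   ∎

  const-· : ∀ n → const (n K.· K.1#) ≈ n · 1#
  const-· zero    = const.0#-homo
  const-· (suc n) = trans (const.+-homo _ _) (+-cong const.1#-homo (const-· n))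

  ∂-·1-* : ∀ n f → ∂ ((n · 1#) * f) ≈ (n · 1#) * ∂ f
  ∂-·1-* n f = begin
    ∂ ((n · 1#) * f)            ≈⟨ ∂-cong (*-congʳ (const-· n)) ⟨
    ∂ (const (n K.· K.1#) * f)  ≈⟨ ∂-const-* _ f ⟩
    const (n K.· K.1#) * ∂ f    ≈⟨ *-congʳ (const-· n) ⟩
    (n · 1#) * ∂ f              ∎

  ∂-^ : ∀ f n → ∂ (f ^ suc n) ≈ (suc n · 1#) * (f ^ n * ∂ f)
  ∂-^ f zero = begin
    ∂ (f * 1#)            ≈⟨ ∂-cong (*-identityʳ f) ⟩
    ∂ f                   ≈⟨ solve 1 (λ x → x := (con 1 :+ con 0) :* (con 1 :* x)) refl (∂ f) ⟩
    (1# + 0#) * (1# * ∂ f) ∎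
  ∂-^ f (suc n) = begin
    ∂ (f * f ^ suc n)
      ≈⟨ ∂-* f (f ^ suc n) ⟩
    ∂ f * (f * f ^ n) + f * ∂ (f ^ suc n)
      ≈⟨ +-congˡ (*-congˡ (∂-^ f n)) ⟩
    ∂ f * (f * f ^ n) + f * ((suc n · 1#) * (f ^ n * ∂ f))
      ≈⟨ solve 4 (λ f′ f fⁿ n → f′ :* (f :* fⁿ) :+ f :* (n :* (fⁿ :* f′))
                             := (con 1 :+ n) :* ((f :* fⁿ) :* f′)) refl (∂ f) f (f ^ n) (suc n · 1#) ⟩
    (suc (suc n) · 1#) * (f ^ suc n * ∂ f) ∎

  -- The extra factor f restores the exponent lowered by ∂, so that n = 0 fits the same formula.
  *-∂-^ : ∀ f n → f * ∂ (f ^ n) ≈ (n · 1#) * (f ^ n * ∂ f)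
  *-∂-^ f zero    = trans (trans (*-congˡ ∂-1) (zeroʳ f)) (sym (zeroˡ _))
  *-∂-^ f (suc n) = trans (*-congˡ (∂-^ f n))
    (solve 4 (λ f n fⁿ f′ → f :* (n :* (fⁿ :* f′)) := n :* ((f :* fⁿ) :* f′)) refl f (suc n · 1#) (f ^ n) (∂ f))

  ∂-z* : ∀ f → ∂ (z * f) ≈ f + z * ∂ f
  ∂-z* f = trans (∂-* z f) (+-congʳ (trans (*-congʳ ∂-z) (*-identityˡ f)))

  -- Polynomials in z

  -- Horner form exposes the constant term, from which the value at 0 is read off. Coefficients may
  -- be zero, leading ones included, so no equality in K has to be decided.
  data Polynomial : Carrier → Set (c ⊔ a ⊔ ℓ) where
    zeroᴾ  : ∀ {f} → f ≈ 0# → Polynomial f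
    horner : ∀ x {f g} → Polynomial g → f ≈ const x + z * g → Polynomial f

  polynomial-cong : ∀ {f g} → f ≈ g → Polynomial f → Polynomial g
  polynomial-cong f≈g (zeroᴾ f≈0)     = zeroᴾ (trans (sym f≈g) f≈0)
  polynomial-cong f≈g (horner x p eq) = horner x p (trans (sym f≈g) eq)

  polynomial-const : ∀ x → Polynomial (const x)
  polynomial-const x = horner x (zeroᴾ refl) (sym (trans (+-congˡ (zeroʳ z)) (+-identityʳ _)))

  polynomial-1 : Polynomial 1#
  polynomial-1 = polynomial-cong const.1#-homo (polynomial-const K.1#)

  polynomial-z* : ∀ {f} → Polynomial f → Polynomial (z * f)
  polynomial-z* p = horner K.0# p (sym (trans (+-congʳ const.0#-homo) (+-identityˡ _)))

  polynomial-+ : ∀ {f g} → Polynomial f → Polynomial g → Polynomial (f + g)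
  polynomial-+ (zeroᴾ f≈0) q = polynomial-cong (sym (trans (+-congʳ f≈0) (+-identityˡ _))) q
  polynomial-+ p@(horner _ _ _) (zeroᴾ g≈0) =
    polynomial-cong (sym (trans (+-congˡ g≈0) (+-identityʳ _))) p
  polynomial-+ (horner x {g = f} p eq) (horner y {g = g} q eq′) =
    horner (x K.+ y) (polynomial-+ p q)
      (trans (+-cong eq eq′)
      (trans (solve 5 (λ x y z f g → (x :+ z :* f) :+ (y :+ z :* g) := (x :+ y) :+ z :* (f :+ g))
               refl (const x) (const y) z f g)
             (+-congʳ (sym (const.+-homo x y)))))

  polynomial-const* : ∀ x {f} → Polynomial f → Polynomial (const x * f)
  polynomial-const* x (zeroᴾ f≈0) = zeroᴾ (trans (*-congˡ f≈0) (zeroʳ _))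
  polynomial-const* x (horner y {g = g} p eq) =
    horner (x K.* y) (polynomial-const* x p)
      (trans (*-congˡ eq)
      (trans (solve 4 (λ x y z g → x :* (y :+ z :* g) := x :* y :+ z :* (x :* g))
               refl (const x) (const y) z g)
             (+-congʳ (sym (const.*-homo x y)))))

  polynomial-* : ∀ {f g} → Polynomial f → Polynomial g → Polynomial (f * g)
  polynomial-* (zeroᴾ f≈0) q = zeroᴾ (trans (*-congʳ f≈0) (zeroˡ _))
  polynomial-* {g = g} (horner x {g = f} p eq) q =
    polynomial-cong
      (trans (solve 4 (λ x z f g → x :* g :+ z :* (f :* g) := (x :+ z :* f) :* g)
               refl (const x) z f g)
             (*-congʳ (sym eq)))
      (polynomial-+ (polynomial-const* x q) (polynomial-z* (polynomial-* p q)))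

  polynomial-·1 : ∀ n → Polynomial (n · 1#)
  polynomial-·1 n = polynomial-cong (const-· n) (polynomial-const _)

  polynomial-^ : ∀ {f} n → Polynomial f → Polynomial (f ^ n)
  polynomial-^ zero    p = polynomial-1
  polynomial-^ (suc n) p = polynomial-* p (polynomial-^ n p)

  polynomial-∂ : ∀ {f} → Polynomial f → Polynomial (∂ f)
  polynomial-∂ (zeroᴾ f≈0) = zeroᴾ (trans (∂-cong f≈0) ∂-0)
  polynomial-∂ {f} (horner x {g = g} p eq) =
    polynomial-cong (sym ∂f≈) (polynomial-+ p (polynomial-z* (polynomial-∂ p)))
    where
    ∂f≈ : ∂ f ≈ g + z * ∂ g
    ∂f≈ = begin
      ∂ f                       ≈⟨ ∂-cong eq ⟩
      ∂ (const x + z * g)       ≈⟨ ∂-+ _ _ ⟩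
      ∂ (const x) + ∂ (z * g)   ≈⟨ +-cong (∂-const x) (∂-z* g) ⟩
      0# + (g + z * ∂ g)        ≈⟨ +-identityˡ _ ⟩
      g + z * ∂ g               ∎

  -- z is transcendental over the constants

  eval : List K.Carrier → Carrier
  eval []      = 0#
  eval (x ∷ p) = const x + z * eval p

  coefficients : ∀ {f} → Polynomial f → ∃[ p ] f ≈ eval p
  coefficients (zeroᴾ f≈0) = [] , f≈0
  coefficients (horner x p eq) with coefficients p
  ... | q , g≈q = x ∷ q , trans eq (+-congˡ (*-congˡ g≈q))

  -- scaleFrom n p lists the coefficients of z^(1-n) ∂ (zⁿ p).
  scaleFrom : ℕ → List K.Carrier → List K.Carrier
  scaleFrom n []      = []
  scaleFrom n (x ∷ p) = (n K.· K.1#) K.* x ∷ scaleFrom (suc n) p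

  length-scaleFrom : ∀ n p → length (scaleFrom n p) ≡ length p
  length-scaleFrom n []      = ≡.refl
  length-scaleFrom n (x ∷ p) = ≡.cong suc (length-scaleFrom (suc n) p)

  -- The general power of z serves the induction: splitting off the head of p moves one factor z out
  -- of `eval`. Transcendence uses the case n = 0.
  ∂-z^*eval : ∀ n p → ∂ (z ^ suc n * eval p) ≈ z ^ n * eval (scaleFrom (suc n) p)
  ∂-z^*eval n [] = begin
    ∂ (z ^ suc n * 0#) ≈⟨ ∂-cong (zeroʳ _) ⟩
    ∂ 0#               ≈⟨ ∂-0 ⟩
    0#                 ≈⟨ zeroʳ _ ⟨
    z ^ n * 0#         ∎
  ∂-z^*eval n (x ∷ p) = begin
    ∂ (z ^ suc n * (const x + z * eval p))
      ≈⟨ ∂-cong (solve 4 (λ zⁿ x z p → (z :* zⁿ) :* (x :+ z :* p) := x :* (z :* zⁿ) :+ (z :* (z :* zⁿ)) :* p)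
                  refl (z ^ n) (const x) z (eval p)) ⟩
    ∂ (const x * z ^ suc n + z ^ suc (suc n) * eval p)
      ≈⟨ ∂-+ _ _ ⟩
    ∂ (const x * z ^ suc n) + ∂ (z ^ suc (suc n) * eval p)
      ≈⟨ +-cong (trans (∂-const-* x _) (*-congˡ (trans (∂-^ z n)
                  (*-congˡ (trans (*-congˡ ∂-z) (*-identityʳ _))))))
                (∂-z^*eval (suc n) p) ⟩
    const x * ((suc n · 1#) * z ^ n) + z ^ suc n * eval (scaleFrom (suc (suc n)) p)
      ≈⟨ solve 5 (λ x n zⁿ z p → x :* (n :* zⁿ) :+ (z :* zⁿ) :* p := zⁿ :* (n :* x :+ z :* p))
           refl (const x) (suc n · 1#) (z ^ n) z (eval (scaleFrom (suc (suc n)) p)) ⟩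
    z ^ n * ((suc n · 1#) * const x + z * eval (scaleFrom (suc (suc n)) p))
      ≈⟨ *-congˡ (+-congʳ (trans (const.*-homo _ x) (*-congʳ (const-· (suc n))))) ⟨
    z ^ n * eval (scaleFrom (suc n) (x ∷ p)) ∎

  inverse : ∀ n → ∃[ y ] y K.* (suc n K.· K.1#) K.≈ K.1#
  inverse n with HeytingField.#⇒invertible K (char0 n)
  ... | y , eq , _ = y , K.trans (K.*-congˡ (K.sym n-0≈n)) eq
    where
    n-0≈n : (suc n K.· K.1#) K.+ K.- K.0# K.≈ suc n K.· K.1#
    n-0≈n = K.trans (K.+-congˡ (RingProperties.-0#≈0# K.ring)) (K.+-identityʳ _)

  const-inverse : ∀ n → const (proj₁ (inverse n)) * (suc n · 1#) ≈ 1#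
  const-inverse n = begin
    const y * (suc n · 1#)              ≈⟨ *-congˡ (const-· (suc n)) ⟨
    const y * const (suc n K.· K.1#)    ≈⟨ const.*-homo _ _ ⟨
    const (y K.* (suc n K.· K.1#))      ≈⟨ const.cong (proj₂ (inverse n)) ⟩
    const K.1#                          ≈⟨ const.1#-homo ⟩
    1#                                  ∎
    where
    y = proj₁ (inverse n)

  AllZero : List K.Carrier → Set (c ⊔ ℓ₁)
  AllZero = All (K._≈ K.0#)

  -- The scaling factors n + 1, n + 2, ... are invertible in characteristic zero.
  allZero-scaleFrom : ∀ n p → AllZero (scaleFrom (suc n) p) → AllZero p
  allZero-scaleFrom n []      []         = []
  allZero-scaleFrom n (x ∷ p) (eq ∷ eqs) = x≈0 ∷ allZero-scaleFrom (suc n) p eqs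
    where
    y = proj₁ (inverse n)
    x≈0 : x K.≈ K.0#
    x≈0 = K.trans (K.sym (K.*-identityˡ x))
         (K.trans (K.*-congʳ (K.sym (proj₂ (inverse n))))
         (K.trans (K.*-assoc y _ x) (K.trans (K.*-congˡ eq) (K.zeroʳ y))))

  eval-allZero : ∀ {p} → AllZero p → eval p ≈ 0#
  eval-allZero []         = refl
  eval-allZero (eq ∷ eqs) = trans
    (+-cong (trans (const.cong eq) const.0#-homo) (trans (*-congˡ (eval-allZero eqs)) (zeroʳ z)))
    (+-identityˡ 0#)

  -- Differentiation removes the constant term and scales the other coefficients by 1, 2, ..., so
  -- these vanish by induction; what remains is `const x`, and `const` is injective. The recursion
  -- runs on the length n because `scaleFrom 1 p` is not a sublist of the given list.
  eval-injective : ∀ n p → length p ≡ n → eval p ≈ 0# → AllZero p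
  eval-injective n       []      _  _   = []
  eval-injective (suc n) (x ∷ p) eq p≈0 = x≈0 ∷ p-zero
    where
    ∂p≈0 : eval (scaleFrom 1 p) ≈ 0#
    ∂p≈0 = begin
      eval (scaleFrom 1 p)              ≈⟨ *-identityˡ _ ⟨
      1# * eval (scaleFrom 1 p)         ≈⟨ ∂-z^*eval 0 p ⟨
      ∂ (z * 1# * eval p)               ≈⟨ ∂-cong (*-congʳ (*-identityʳ z)) ⟩
      ∂ (z * eval p)                    ≈⟨ +-identityˡ _ ⟨
      0# + ∂ (z * eval p)               ≈⟨ +-congʳ (∂-const x) ⟨
      ∂ (const x) + ∂ (z * eval p)      ≈⟨ ∂-+ _ _ ⟨
      ∂ (eval (x ∷ p))                  ≈⟨ ∂-cong p≈0 ⟩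
      ∂ 0#                              ≈⟨ ∂-0 ⟩
      0#                                ∎
    p-zero : AllZero p
    p-zero = allZero-scaleFrom 0 p
      (eval-injective n (scaleFrom 1 p) (≡.trans (length-scaleFrom 1 p) (ℕ.suc-injective eq)) ∂p≈0)
    x≈0 : x K.≈ K.0#
    x≈0 = const.injective (begin
      const x                 ≈⟨ +-identityʳ _ ⟨
      const x + 0#            ≈⟨ +-congˡ (trans (*-congˡ (eval-allZero p-zero)) (zeroʳ z)) ⟨
      const x + z * eval p    ≈⟨ p≈0 ⟩
      0#                      ≈⟨ const.0#-homo ⟨
      const K.0#              ∎)

  -- Values at z = 0

  -- Evaluation at 0 is a relation, since only polynomials in z receive a value; `↦-unique` shows
  -- that it is single-valued.
  record _↦_ (f : Carrier) (x : K.Carrier) : Set (c ⊔ a ⊔ ℓ) where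
    constructor value
    field
      {rest}    : Carrier
      rest-poly : Polynomial rest
      split     : f ≈ const x + z * rest

  infix 4 _↦_

  ↦-polynomial : ∀ {f x} → f ↦ x → Polynomial f
  ↦-polynomial (value p eq) = horner _ p eq

  ↦-cong : ∀ {f g x y} → f ≈ g → x K.≈ y → f ↦ x → g ↦ y
  ↦-cong f≈g x≈y (value p eq) = value p (trans (sym f≈g) (trans eq (+-congʳ (const.cong x≈y))))

  ↦-const : ∀ x → const x ↦ x
  ↦-const x = value (zeroᴾ refl) (sym (trans (+-congˡ (zeroʳ z)) (+-identityʳ _)))

  ↦-0 : ∀ {f} → f ≈ 0# → f ↦ K.0#
  ↦-0 f≈0 = ↦-cong (trans const.0#-homo (sym f≈0)) K.refl (↦-const K.0#)

  ↦-1 : 1# ↦ K.1#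
  ↦-1 = ↦-cong const.1#-homo K.refl (↦-const K.1#)

  ↦-·1 : ∀ n → n · 1# ↦ n K.· K.1#
  ↦-·1 n = ↦-cong (const-· n) K.refl (↦-const _)

  ↦-z* : ∀ {f} → Polynomial f → z * f ↦ K.0#
  ↦-z* p = value p (sym (trans (+-congʳ const.0#-homo) (+-identityˡ _)))

  ↦-+ : ∀ {f g x y} → f ↦ x → g ↦ y → f + g ↦ x K.+ y
  ↦-+ {x = x} {y} (value {f} p eq) (value {g} q eq′) = value (polynomial-+ p q)
    (trans (+-cong eq eq′)
    (trans (solve 5 (λ x y z f g → (x :+ z :* f) :+ (y :+ z :* g) := (x :+ y) :+ z :* (f :+ g))
             refl (const x) (const y) z f g)
           (+-congʳ (sym (const.+-homo x y)))))

  ↦-* : ∀ {f g x y} → f ↦ x → g ↦ y → f * g ↦ x K.* y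
  ↦-* {g = h} {x} {y} (value {f} p eq) v@(value {g} q eq′) =
    value (polynomial-+ (polynomial-const* x q) (polynomial-* p (↦-polynomial v)))
    (begin
      _ * h                                           ≈⟨ *-congʳ eq ⟩
      (const x + z * f) * h                           ≈⟨ distribʳ _ _ _ ⟩
      const x * h + z * f * h                         ≈⟨ +-congʳ (*-congˡ eq′) ⟩
      const x * (const y + z * g) + z * f * h         ≈⟨ solve 6 (λ x y z f g h →
        x :* (y :+ z :* g) :+ z :* f :* h := x :* y :+ z :* (x :* g :+ f :* h))
          refl (const x) (const y) z f g h ⟩
      const x * const y + z * (const x * g + f * h)   ≈⟨ +-congʳ (const.*-homo x y) ⟨
      const (x K.* y) + z * (const x * g + f * h)     ∎)

  ↦-^ : ∀ {f} n → f ↦ K.1# → f ^ n ↦ K.1#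
  ↦-^ zero    v = ↦-1
  ↦-^ (suc n) v = ↦-cong refl (K.*-identityˡ _) (↦-* v (↦-^ n v))

  ↦-∑ : ∀ {b} {X : Set b} (xs : List X) {F : X → Carrier} {φ : X → K.Carrier} →
        (∀ {x} → x ∈ xs → F x ↦ φ x) → ∑ xs F ↦ K.∑ xs φ
  ↦-∑ []       v = ↦-0 refl
  ↦-∑ (x ∷ xs) v = ↦-+ (v (here ≡.refl)) (↦-∑ xs (v ∘ there))

  -- Put in front of the coefficients of the remainder, x heads a list whose evaluation at z is 0,
  -- so it vanishes by transcendence.
  ↦-0-unique : ∀ {x} → 0# ↦ x → x K.≈ K.0#
  ↦-0-unique (value p eq) with coefficients p
  ... | q , g≈q with eval-injective _ (_ ∷ q) ≡.refl (sym (trans eq (+-congˡ (*-congˡ g≈q))))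
  ...   | x≈0 ∷ _ = x≈0

  ↦-unique : ∀ {f x y} → f ↦ x → f ↦ y → x K.≈ y
  ↦-unique {f} {x} {y} v w = K.x∙y⁻¹≈ε⇒x≈y x y (↦-0-unique
    -- The difference is formed as f + (-1) f, so that the rules for sums and products give its
    -- value x - y.
    (↦-cong f-f≈0 x+-1y≈x-y (↦-+ v (↦-* (↦-const (K.- K.1#)) w))))
    where
    f-f≈0 : f + const (K.- K.1#) * f ≈ 0#
    f-f≈0 = begin
      f + const (K.- K.1#) * f
        ≈⟨ +-congˡ (*-congʳ (trans (const.-‿homo K.1#) (-‿cong const.1#-homo))) ⟩
      f + - 1# * f              ≈⟨ +-congˡ (RingProperties.-1*x≈-x ring f) ⟩
      f + - f                   ≈⟨ -‿inverseʳ f ⟩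
      0#                        ∎
    x+-1y≈x-y : x K.+ K.- K.1# K.* y K.≈ x K.+ K.- y
    x+-1y≈x-y = K.+-congˡ (RingProperties.-1*x≈-x K.ring y)

  -- Polynomials divisible by zⁿ

  Vanishes : ℕ → Carrier → Set (c ⊔ a ⊔ ℓ)
  Vanishes zero    f = Polynomial f
  Vanishes (suc n) f = ∃[ g ] Vanishes n g × f ≈ z * g

  vanishes-polynomial : ∀ n {f} → Vanishes n f → Polynomial f
  vanishes-polynomial zero    p            = p
  vanishes-polynomial (suc n) (g , v , eq) =
    polynomial-cong (sym eq) (polynomial-z* (vanishes-polynomial n v))

  vanishes-cong : ∀ n {f g} → f ≈ g → Vanishes n f → Vanishes n g
  vanishes-cong zero    f≈g p            = polynomial-cong f≈g p
  vanishes-cong (suc n) f≈g (h , v , eq) = h , v , trans (sym f≈g) eq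

  vanishes-0 : ∀ n → Vanishes n 0#
  vanishes-0 zero    = zeroᴾ refl
  vanishes-0 (suc n) = 0# , vanishes-0 n , sym (zeroʳ z)

  vanishes-+ : ∀ n {f g} → Vanishes n f → Vanishes n g → Vanishes n (f + g)
  vanishes-+ zero    p            q              = polynomial-+ p q
  vanishes-+ (suc n) (f , v , eq) (g , w , eq′) =
    f + g , vanishes-+ n v w , trans (+-cong eq eq′) (sym (distribˡ z f g))

  vanishes-* : ∀ n {f g} → Polynomial f → Vanishes n g → Vanishes n (f * g)
  vanishes-* zero    p q                    = polynomial-* p q
  vanishes-* (suc n) {f} p (g , v , eq) = f * g , vanishes-* n p v ,
    trans (*-congˡ eq) (solve 3 (λ f z g → f :* (z :* g) := z :* (f :* g)) refl f z g)

  vanishes-≤ : ∀ {m n f} → m ≤ n → Vanishes n f → Vanishes m f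
  vanishes-≤ {n = n} z≤n v           = vanishes-polynomial n v
  vanishes-≤ (s≤s m≤n) (g , v , eq)  = g , vanishes-≤ m≤n v , eq

  -- If f = z g then ∂ f = g + z ∂ g. Here g has one factor z fewer than f, and the factor lost in ∂
  -- g is returned by z.
  vanishes-∂ : ∀ n {f} → Vanishes (suc n) f → Vanishes n (∂ f)
  vanishes-∂ zero    v            = polynomial-∂ (vanishes-polynomial 1 v)
  vanishes-∂ (suc n) (g , v , eq) =
    vanishes-cong (suc n) (sym (trans (∂-cong eq) (∂-z* g)))
      (vanishes-+ (suc n) v (∂ g , vanishes-∂ n v , refl))

  vanishes-↦ : ∀ n {f} → Vanishes (suc n) f → f ↦ K.0#
  vanishes-↦ n (g , v , eq) = ↦-cong (sym eq) K.refl (↦-z* (vanishes-polynomial n v))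

  -- Divided powers and their derivatives at 0

  -- zⁿ / n!
  dividedPower : ℕ → Carrier
  dividedPower zero    = 1#
  dividedPower (suc n) = const (proj₁ (inverse n)) * (z * dividedPower n)

  dividedPower-vanishes : ∀ n → Vanishes n (dividedPower n)
  dividedPower-vanishes zero    = polynomial-1
  dividedPower-vanishes (suc n) = vanishes-* (suc n) (polynomial-const _)
    (dividedPower n , dividedPower-vanishes n , refl)

  -- Euler's identity for a homogeneous function of degree n. It is proved together with the
  -- derivative formula: Euler in degree n gives the derivative in degree n + 1, which gives Euler
  -- in degree n + 1.
  z-∂-dividedPower : ∀ n → z * ∂ (dividedPower n) ≈ (n · 1#) * dividedPower n
  ∂-dividedPower   : ∀ n → ∂ (dividedPower (suc n)) ≈ dividedPower n

  z-∂-dividedPower zero    = trans (*-congˡ ∂-1) (trans (zeroʳ z) (sym (zeroˡ _)))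
  z-∂-dividedPower (suc n) = begin
    z * ∂ (dividedPower (suc n))          ≈⟨ *-congˡ (∂-dividedPower n) ⟩
    z * e                                 ≈⟨ *-identityˡ _ ⟨
    1# * (z * e)                          ≈⟨ *-congʳ (const-inverse n) ⟨
    (const y * (suc n · 1#)) * (z * e)
      ≈⟨ solve 4 (λ y n z e → (y :* n) :* (z :* e) := n :* (y :* (z :* e))) refl (const y) (suc n · 1#) z e ⟩
    (suc n · 1#) * (const y * (z * e))    ∎
    where
    e = dividedPower n
    y = proj₁ (inverse n)

  ∂-dividedPower n = begin
    ∂ (const y * (z * e))                 ≈⟨ ∂-const-* y _ ⟩
    const y * ∂ (z * e)                   ≈⟨ *-congˡ (∂-z* e) ⟩
    const y * (e + z * ∂ e)               ≈⟨ *-congˡ (+-congˡ (z-∂-dividedPower n)) ⟩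
    const y * (e + (n · 1#) * e)
      ≈⟨ solve 3 (λ y e n → y :* (e :+ n :* e) := (y :* (con 1 :+ n)) :* e) refl (const y) e (n · 1#) ⟩
    (const y * (suc n · 1#)) * e          ≈⟨ *-congʳ (const-inverse n) ⟩
    1# * e                                ≈⟨ *-identityˡ e ⟩
    e                                     ∎
    where
    e = dividedPower n
    y = proj₁ (inverse n)

  dividedPower-polynomial : ∀ n → Polynomial (dividedPower n)
  dividedPower-polynomial n = vanishes-polynomial n (dividedPower-vanishes n)

  dividedPower-suc-↦ : ∀ n → dividedPower (suc n) ↦ K.0#
  dividedPower-suc-↦ n = vanishes-↦ n (dividedPower-vanishes (suc n))

  -- Kronecker's delta, by the same recursion that lowers the order of ∂ and the divided power
  -- together.
  δ : ℕ → ℕ → K.Carrier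
  δ zero    zero    = K.1#
  δ zero    (suc n) = K.0#
  δ (suc j) zero    = K.0#
  δ (suc j) (suc n) = δ j n

  δ-refl : ∀ n → δ n n ≡ K.1#
  δ-refl zero    = ≡.refl
  δ-refl (suc n) = δ-refl n

  δ-≢ : ∀ {j n} → j ≢ n → δ j n ≡ K.0#
  δ-≢ {zero}  {zero}  j≢n = contradiction ≡.refl j≢n
  δ-≢ {zero}  {suc n} j≢n = ≡.refl
  δ-≢ {suc j} {zero}  j≢n = ≡.refl
  δ-≢ {suc j} {suc n} j≢n = δ-≢ (j≢n ∘ ≡.cong suc)

  power-∂-cong : ∀ j {f g} → f ≈ g → power 𝓜 ∂ j f ≈ power 𝓜 ∂ j g
  power-∂-cong zero    f≈g = f≈g
  power-∂-cong (suc j) f≈g = ∂-cong (power-∂-cong j f≈g)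

  power-∂-0 : ∀ j → power 𝓜 ∂ j 0# ≈ 0#
  power-∂-0 zero    = refl
  power-∂-0 (suc j) = trans (∂-cong (power-∂-0 j)) ∂-0

  -- `power` adds derivatives on the outside, whereas a divided power simplifies under the innermost
  -- one.
  power-∂-shift : ∀ j f → ∂ (power 𝓜 ∂ j f) ≈ power 𝓜 ∂ j (∂ f)
  power-∂-shift zero    f = refl
  power-∂-shift (suc j) f = ∂-cong (power-∂-shift j f)

  power-∂-dividedPower-↦ : ∀ j n → power 𝓜 ∂ j (dividedPower n) ↦ δ j n
  power-∂-dividedPower-↦ zero    zero    = ↦-1
  power-∂-dividedPower-↦ zero    (suc n) = dividedPower-suc-↦ n
  power-∂-dividedPower-↦ (suc j) zero    =
    ↦-0 (trans (power-∂-shift j 1#) (trans (power-∂-cong j ∂-1) (power-∂-0 j)))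
  power-∂-dividedPower-↦ (suc j) (suc n) = ↦-cong
    (sym (trans (power-∂-shift j _) (power-∂-cong j (∂-dividedPower n))))
    K.refl (power-∂-dividedPower-↦ j n)

  -- The truncated exponential and its jets

  truncatedExp : ℕ → Carrier
  truncatedExp zero    = 1#
  truncatedExp (suc n) = dividedPower (suc n) + truncatedExp n

  -- Differentiation moves every summand down one place and kills the constant 1, so only the top
  -- summand is lost.
  ∂-truncatedExp : ∀ n → ∂ (truncatedExp (suc n)) ≈ truncatedExp n
  ∂-truncatedExp n = trans (∂-+ _ _) (trans (+-congʳ (∂-dividedPower n)) (lemma n))
    where
    lemma : ∀ n → dividedPower n + ∂ (truncatedExp n) ≈ truncatedExp n
    lemma zero    = trans (+-congˡ ∂-1) (+-identityʳ _)
    lemma (suc n) = +-congˡ (∂-truncatedExp n)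

  truncatedExp-↦ : ∀ n → truncatedExp n ↦ K.1#
  truncatedExp-↦ zero    = ↦-1
  truncatedExp-↦ (suc n) =
    ↦-cong refl (K.+-identityˡ _) (↦-+ (dividedPower-suc-↦ n) (truncatedExp-↦ n))

  -- An s-tuple involves at most s derivatives. Truncation order s + m survives them all, so each
  -- derivative is again a truncated exponential, with value 1. Since `jetMonomial` recurses on ∂ u,
  -- u is given up to equality in the ring.
  jetMonomial-↦ : ∀ m {s u} (α : Vec ℕ s) → u ≈ truncatedExp (s ℕ.+ m) → jetMonomial 𝓜 u α ↦ K.1#
  jetMonomial-↦ m         []      u≈ = ↦-1
  jetMonomial-↦ m {suc s} {u} (i ∷ α) u≈ = ↦-cong refl (K.*-identityˡ _)
    (↦-* (↦-^ i (↦-cong (sym ∂u≈) K.refl (truncatedExp-↦ (s ℕ.+ m)))) (jetMonomial-↦ m α ∂u≈))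
    where
    ∂u≈ : ∂ u ≈ truncatedExp (s ℕ.+ m)
    ∂u≈ = trans (∂-cong u≈) (∂-truncatedExp (s ℕ.+ m))

  -- Powers of u ∂ on a truncated exponential

  -- (∂ + k - 1) ⋯ (∂ + 1) ∂
  rising : ℕ → Carrier → Carrier
  rising zero    f = f
  rising (suc k) f = ∂ (rising k f) + (k · 1#) * rising k f

  rising-cong : ∀ k {f g} → f ≈ g → rising k f ≈ rising k g
  rising-cong zero    f≈g = f≈g
  rising-cong (suc k) f≈g = +-cong (∂-cong (rising-cong k f≈g)) (*-congˡ (rising-cong k f≈g))

  rising-0 : ∀ k → rising k 0# ≈ 0#
  rising-0 zero    = refl
  rising-0 (suc k) = trans
    (+-cong (trans (∂-cong (rising-0 k)) ∂-0) (trans (*-congˡ (rising-0 k)) (zeroʳ _)))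
    (+-identityˡ 0#)

  -- An operator with constant coefficients commutes with ∂.
  ∂-rising : ∀ k f → ∂ (rising k f) ≈ rising k (∂ f)
  ∂-rising zero    f = refl
  ∂-rising (suc k) f = trans (∂-+ _ _)
    (+-cong (∂-cong (∂-rising k f)) (trans (∂-·1-* k _) (*-congˡ (∂-rising k f))))

  rising-polynomial : ∀ k {f} → Polynomial f → Polynomial (rising k f)
  rising-polynomial zero    p = p
  rising-polynomial (suc k) p = polynomial-+ (polynomial-∂ (rising-polynomial k p))
    (polynomial-* (polynomial-·1 k) (rising-polynomial k p))

  -- Applying a polynomial in ∂ to zⁿ / n! and evaluating at 0 extracts its coefficient of ∂ⁿ. The
  -- factor ∂ + k produces the recurrence of `unsignedStirling`.
  rising-dividedPower-↦ : ∀ k n → rising k (dividedPower n) ↦ unsignedStirling k n K.· K.1#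
  rising-dividedPower-↦ zero    zero    = ↦-cong refl (K.sym (K.+-identityʳ _)) ↦-1
  rising-dividedPower-↦ zero    (suc n) = dividedPower-suc-↦ n
  rising-dividedPower-↦ (suc k) zero    = ↦-cong refl
    (K.trans (K.+-identityˡ _) (K.sym (K.×1-homo-* k (unsignedStirling k 0))))
    (↦-+ (↦-0 (trans (∂-rising k 1#) (trans (rising-cong k ∂-1) (rising-0 k))))
         (↦-* (↦-·1 k) (rising-dividedPower-↦ k 0)))
  rising-dividedPower-↦ (suc k) (suc n) = ↦-cong refl
    (K.sym (K.trans (K.×-homo-+ K.1# (unsignedStirling k n) _)
                    (K.+-congˡ (K.×1-homo-* k (unsignedStirling k (suc n))))))
    (↦-+ (↦-cong (sym (trans (∂-rising k _) (rising-cong k (∂-dividedPower n))))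
                 K.refl (rising-dividedPower-↦ k n))
         (↦-* (↦-·1 k) (rising-dividedPower-↦ k (suc n))))

  -- For an honest exponential, (u ∂)(uⁱ g) = uⁱ⁺¹ (∂ + i) g; each application
  -- of u ∂ costs one order of the truncation error.
  power-A-rising : ∀ {N u ε f} → Polynomial u → Vanishes N ε → ∂ u + ε ≈ u → Polynomial f →
                   ∀ i m → i ℕ.+ m ≡ N →
                   ∃[ r ] Vanishes m r × power 𝓜 (A 𝓜 u) i f + r ≈ u ^ i * rising i f
  power-A-rising {f = f} pu vε ∂u+ε≈u pf zero m i+m≡N = 0# , vanishes-0 m ,
    trans (+-identityʳ f) (sym (*-identityˡ f))
  power-A-rising {N} {u} {ε} {f} pu vε ∂u+ε≈u pf (suc i) m i+m≡N
    with power-A-rising pu vε ∂u+ε≈u pf i (suc m) (≡.trans (ℕ.+-suc i m) i+m≡N)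
  ... | r , vr , eq = r′ , vr′ , eq′
    where
    P = power 𝓜 (A 𝓜 u) i f
    Q = rising i f
    n = i · 1#
    -- The first term is the old error carried through u ∂; the second pays for replacing ∂ u by u
    -- when uⁱ is differentiated.
    r′ = u * ∂ r + (n * u ^ i * Q) * ε
    vr′ : Vanishes m r′
    vr′ = vanishes-+ m (vanishes-* m pu (vanishes-∂ m vr))
      (vanishes-* m
        (polynomial-* (polynomial-* (polynomial-·1 i) (polynomial-^ i pu)) (rising-polynomial i pf))
        (vanishes-≤ (≡.subst (m ≤_) i+m≡N (ℕ.m≤n+m m (suc i))) vε))
    eq′ : u * ∂ P + r′ ≈ u ^ suc i * (∂ Q + n * Q)
    eq′ = begin
      u * ∂ P + (u * ∂ r + (n * u ^ i * Q) * ε)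
        ≈⟨ solve 4 (λ u p r e → u :* p :+ (u :* r :+ e) := u :* (p :+ r) :+ e)
             refl u (∂ P) (∂ r) ((n * u ^ i * Q) * ε) ⟩
      u * (∂ P + ∂ r) + (n * u ^ i * Q) * ε
        ≈⟨ +-congʳ (*-congˡ (trans (sym (∂-+ P r)) (trans (∂-cong eq) (∂-* (u ^ i) Q)))) ⟩
      u * (∂ (u ^ i) * Q + u ^ i * ∂ Q) + (n * u ^ i * Q) * ε
        ≈⟨ solve 6 (λ u v q w q′ e → u :* (v :* q :+ w :* q′) :+ e := (u :* v) :* q :+ u :* w :* q′ :+ e)
             refl u (∂ (u ^ i)) Q (u ^ i) (∂ Q) ((n * u ^ i * Q) * ε) ⟩
      (u * ∂ (u ^ i)) * Q + u * u ^ i * ∂ Q + (n * u ^ i * Q) * ε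
        ≈⟨ +-congʳ (+-congʳ (*-congʳ (*-∂-^ u i))) ⟩
      (n * (u ^ i * ∂ u)) * Q + u * u ^ i * ∂ Q + (n * u ^ i * Q) * ε
        ≈⟨ solve 7 (λ n w u u′ q q′ e → (n :* (w :* u′)) :* q :+ u :* w :* q′ :+ (n :* w :* q) :* e
                                     := (n :* w :* q) :* (u′ :+ e) :+ u :* w :* q′)
             refl n (u ^ i) u (∂ u) Q (∂ Q) ε ⟩
      (n * u ^ i * Q) * (∂ u + ε) + u * u ^ i * ∂ Q
        ≈⟨ +-congʳ (*-congˡ ∂u+ε≈u) ⟩
      (n * u ^ i * Q) * u + u * u ^ i * ∂ Q
        ≈⟨ solve 5 (λ n w u q q′ → (n :* w :* q) :* u :+ u :* w :* q′ := (u :* w) :* (q′ :+ n :* q))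
             refl n (u ^ i) u Q (∂ Q) ⟩
      u ^ suc i * (∂ Q + n * Q) ∎

  power-A-dividedPower-value : ∀ k n {x} →
    power 𝓜 (A 𝓜 (truncatedExp (suc k))) k (dividedPower n) ↦ x →
    x K.≈ unsignedStirling k n K.· K.1#
  power-A-dividedPower-value k n {x} v
    -- The defect ε of ∂ u = u is the top term of u, divisible by z to the power k + 1. After k
    -- applications the error still has one factor z, so its value at 0 is 0.
    with power-A-rising (↦-polynomial (truncatedExp-↦ (suc k))) (dividedPower-vanishes (suc k))
           (trans (+-congʳ (∂-truncatedExp k)) (+-comm _ _)) (dividedPower-polynomial n)
           k 1 (ℕ.+-comm k 1)
  ... | r , vr , eq = K.trans (K.sym (K.+-identityʳ x)) (K.trans
    (↦-unique (↦-cong eq K.refl (↦-+ v (vanishes-↦ 0 vr)))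
              (↦-* (↦-^ k (truncatedExp-↦ (suc k))) (rising-dividedPower-↦ k n)))
    (K.*-identityˡ _))

  -- Comparison of the two values at 0

  module _ (C : Coefficients K) (C-universal : IsUniversal 𝓜 C) where
    open IsUniversal C-universal

    -- The leading term of the expansion becomes the summand s = 0, where `coefficientSum` is 1 by
    -- convention; hence the sum starts at 0.
    expansion-↦ : ∀ k n →
      expansion 𝓜 C (suc k) (truncatedExp (suc (suc k))) (dividedPower n) ↦
      K.∑ (List.upTo (suc k)) (λ s → coefficientSum K C (suc k) s K.* δ (suc k ∸ s) n)
    expansion-↦ k n = ↦-+
      (↦-* (↦-^ (suc k) u-↦) (power-∂-dividedPower-↦ (suc k) n))
      (↦-∑ [1⋯ k ] λ {s} s∈ →
        ↦-* (coefficient-↦ s∈) (power-∂-dividedPower-↦ (suc k ∸ s) n))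
      where
      -- The truncation order exceeds the power k + 1 of the operator by one, as in
      -- `power-A-dividedPower-value`.
      u = truncatedExp (suc (suc k))
      u-↦ : u ↦ K.1#
      u-↦ = truncatedExp-↦ (suc (suc k))
      coefficient-↦ : ∀ {s} → s ∈ [1⋯ k ] →
        (∑[ m ∈ [1⋯ s ] ] (u ^ (suc k ∸ m)) *
          (∑[ α ∈ admissibleTuples m s ] (const (C s m (suc k) α) * jetMonomial 𝓜 u α)))
        ↦ coefficientSum K C (suc k) s
      coefficient-↦ {s} s∈ with ∈-applyUpTo⁻ suc s∈
      ... | i , i<k , ≡.refl = ↦-∑ [1⋯ s ] λ {m} _ → ↦-cong refl (K.*-identityˡ _)
        (↦-* (↦-^ (suc k ∸ m) u-↦)
          (↦-∑ (admissibleTuples m s) λ {α} _ → ↦-cong refl (K.*-identityʳ _)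
            (↦-* (↦-const _) (jetMonomial-↦ (suc (suc k) ∸ s) α (reflexive (≡.cong truncatedExp
              (≡.sym (ℕ.m+[n∸m]≡n (ℕ.≤-trans i<k (ℕ.≤-trans (ℕ.n≤1+n k) (ℕ.n≤1+n (suc k))))))))))))

    -- With n = k - s the delta isolates the summand s of the expansion, while the left side of the
    -- operator identity has value c(k , k - s).
    coefficientSum-< : ∀ k s → s < k →
      coefficientSum K C k s K.≈ unsignedStirling k (k ∸ s) K.· K.1#
    coefficientSum-< k@(suc k′) s s<k = K.trans
      (K.sym (K.trans (Sums.∑-single (scalars K) id k s<k others≈0) (K.trans
        (K.*-congˡ (K.reflexive (δ-refl (k ∸ s)))) (K.*-identityʳ _))))
      (power-A-dividedPower-value k (k ∸ s)
        (↦-cong (sym (operator-identity k (s≤s z≤n) _ _)) K.refl (expansion-↦ k′ (k ∸ s))))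
      where
      others≈0 : ∀ {i} → i < k → i ≢ s → coefficientSum K C k i K.* δ (k ∸ i) (k ∸ s) K.≈ K.0#
      others≈0 i<k i≢s = K.trans
        -- Truncated subtraction from k is injective on arguments up to k, so distinct indices i and
        -- s give distinct orders.
        (K.*-congˡ (K.reflexive (δ-≢ (i≢s ∘ ℕ.∸-cancelˡ-≡ (ℕ.<⇒≤ i<k) (ℕ.<⇒≤ s<k)))))
        (K.zeroʳ _)

    coefficientSum-boundary : ∀ k → coefficientSum K C (suc k) (suc k) K.≈ K.0#
    coefficientSum-boundary k = ∑-zero [1⋯ suc k ] inner≈0
      where
      open Sums (scalars K)
      inner≈0 : ∀ {m} → m ∈ [1⋯ suc k ] →
                K.∑ (admissibleTuples m (suc k)) (C (suc k) m (suc k)) K.≈ K.0#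
      inner≈0 {m} m∈ with ∈-applyUpTo⁻ suc m∈
      ... | i , i<k , ≡.refl = ∑-zero (admissibleTuples m (suc k)) λ {α} α∈ →
        boundary (suc k) m (s≤s z≤n) i<k α (Equivalence.to (∈-admissibleTuples m (suc k) α) α∈)

    coefficientSum≈unsignedStirling : ∀ k s → 1 ≤ k → s ≤ k →
      coefficientSum K C k s K.≈ unsignedStirling k (k ∸ s) K.· K.1#
    coefficientSum≈unsignedStirling k@(suc k′) s _ s≤k with ℕ.m≤n⇒m<n∨m≡n s≤k
    ... | inj₁ s<k    = coefficientSum-< k s s<k
    -- At s = k both sides vanish: the left by the boundary convention, the right because c(k , 0) =
    -- 0 for positive k.
    ... | inj₂ ≡.refl = K.trans (coefficientSum-boundary k′) (K.sym (K.×-congˡ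
      (≡.trans (≡.cong (unsignedStirling k) (ℕ.n∸n≡0 k)) (unsignedStirling-zero k′))))

corollary3p3 : ∀ {c ℓ₁ ℓ₂ a ℓ} (K : HeytingField c ℓ₁ ℓ₂) → CharZero K →
    (𝓜 : FunctionRing K a ℓ) (C : Coefficients K) → IsUniversal 𝓜 C →
    ∀ (k : ℕ) → 1 ≤ k → ∀ (s : ℕ) → s ≤ k →
    HeytingField._≈_ K (coefficientSum K C k s) (signedStirling K k s)
corollary3p3 K char0 𝓜 C C-universal k 1≤k s s≤k = trans
  (Evaluation.coefficientSum≈unsignedStirling char0 𝓜 C C-universal k s 1≤k s≤k)
  (reflexive (≡.cong fromℤ (≡.sym (signed≡unsigned k s s≤k))))
  where open RingNotation (scalars K)
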